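{- Let $s$ and $p$ be positive integers, and write $s=kp+r$ with integers $k\ge 0$ and $0\le r<p$. Then the number of $(s,s+1)$-core partitions $\lambda$ all of whose parts are multiples of $p$ equals the Raney number \[R_{p+1,r+1}(k)=\frac{r+1}{k(p+1)+r+1}\binom{k(p+1)+r+1}{k}.\] Equivalently, this number equals $\frac{s+1-p\lfloor s/p\rfloor}{s+1}\binom{s+\lfloor s/p\rfloor}{s}$.
   Context: A partition $\lambda=(\lambda_1,\dots,\lambda_m)$ of $n$ is a nonincreasing sequence of positive integers summing to $n$ (the empty partition is allowed). For a box $B$ of the Young diagram, the hook length $h(B)$ is the number of boxes consisting of $B$ itself, the boxes directly to its right and the boxes directly below it. For a positive integer $t$, $\lambda$ is a $t$-core if no box of $\lambda$ has hook length divisible by $t$; $\lambda$ is an $(s,t)$-core if it is both an $s$-core and a $t$-core. -}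

module Defs where

open import Data.Nat using (ℕ; zero; suc; _+_; _*_; _∸_; _≤_; _<_; _≥_; _<?_; >-nonZero)
open import Data.Nat.DivMod using (_/_)
open import Data.Nat.Divisibility using (_∣_)
open import Data.List using (List; []; _∷_; length; filter; drop)
open import Data.List.Relation.Unary.All using (All)
open import Data.List.Relation.Unary.Linked using (Linked)
open import Relation.Nullary using (¬_)

IsPartition : List ℕ → Set
IsPartition μ = All (0 <_) μ × Linked _≥_ μ
  where open import Data.Product using (_×_)

part : List ℕ → ℕ → ℕ
part []       _       = 0
part (x ∷ _)  zero    = x
part (_ ∷ xs) (suc i) = part xs i

-- Box (i , j) (row i, column j, 0-indexed) lies in the Young diagram iff j < part μ i.
-- Its hook length = 1 + arm (boxes to the right) + leg (boxes below).
arm : List ℕ → ℕ → ℕ → ℕ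
arm μ i j = part μ i ∸ suc j

leg : List ℕ → ℕ → ℕ → ℕ
leg μ i j = length (filter (j <?_) (drop (suc i) μ))

hook : List ℕ → ℕ → ℕ → ℕ
hook μ i j = suc (arm μ i j + leg μ i j)

IsCore : ℕ → List ℕ → Set
IsCore t μ = ∀ i j → j < part μ i → ¬ (t ∣ hook μ i j)

divFloor : ℕ → (p : ℕ) → 0 < p → ℕ
divFloor s p h = _/_ s p {{>-nonZero h}}

{-# OPTIONS --safe #-}
module Submission where

open import Defs
open import Data.Bool using (Bool; true; false; T)
open import Data.Empty using (⊥; ⊥-elim)
open import Data.Nat
open import Data.Nat.Combinatorics using (_C_; nCk≡nC[n∸k]; nCk+nC[k+1]≡[n+1]C[k+1])
open import Data.Nat.Divisibility
open import Data.Nat.DivMod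
  using (m≡m%n+[m/n]*n; m%n<n; +-distrib-/-∣ˡ; m<n⇒m/n≡0; m*n/n≡m)
open import Data.Nat.ListAction using (sum)
open import Data.Nat.Properties
open import Data.Nat.Tactic.RingSolver using (solve-∀)
open import Data.List using (List; []; _∷_; length; filter; replicate; _++_; map; applyUpTo)
open import Data.List.Properties
  using (filter-none; filter-accept; length-map; length-++; length-replicate; length-applyUpTo; ∷-injectiveʳ)
open import Data.List.Membership.Propositional using (_∈_)
open import Data.List.Membership.Propositional.Properties
  using (∈-map⁺; ∈-map⁻; ∈-++⁺ˡ; ∈-++⁺ʳ; ∈-++⁻)
open import Data.List.Relation.Unary.All as All using (All; []; _∷_)
open import Data.List.Relation.Unary.AllPairs using ([]; _∷_)
open import Data.List.Relation.Unary.Any using (here; there)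
open import Data.List.Relation.Unary.Linked as Linked using (Linked; []; [-]; _∷_)
open import Data.List.Relation.Unary.Unique.Propositional using (Unique)
import Data.List.Relation.Unary.Unique.Propositional.Properties as Unique
open import Data.Product using (_×_; _,_; proj₁; proj₂; ∃₂; ∃-syntax)
open import Data.Sum using (inj₁; inj₂)
open import Data.Unit using (⊤; tt)
open import Function.Bundles using (_⇔_; mk⇔)
open import Relation.Binary.Definitions using (tri<; tri≈; tri>)
open import Relation.Binary.PropositionalEquality
open import Relation.Nullary using (¬_; yes; no)

-- Read the boundary of a diagram as a word in rows (false) and columns (true), preceded by s
-- columns. The partition is a t-core iff the set of false positions is closed under adding t.
-- Cut the word into lines of length s + 1: closure under s + 1 makes the columns of each
-- residue an initial segment, of height g b, and closure under s says g b ≤ g (b + 1) + 1.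
-- The parts are multiples of p iff in all lines but the first the runs of columns have length
-- divisible by p. Such profiles g are exactly the outputs of a stack machine which either pops the top x
-- and outputs it or pushes p copies of x + 1, started on r copies of 1 above a 0 and making k
-- pushes. With stacks of size q the number N(q, k) of its runs satisfies
-- N(q, k) = N(q - 1, k) + N(q + p, k - 1), which is the Raney recursion.

-- Boundary words and their partitions.

bit : List Bool → ℕ → Bool
bit []      _       = false
bit (b ∷ _) zero    = b
bit (_ ∷ w) (suc n) = bit w n

ones : List Bool → ℕ
ones []          = 0
ones (true ∷ w)  = suc (ones w)
ones (false ∷ w) = ones w

-- Falses after the last true, like those by which `bit` continues a word past its end, are rows of
-- length 0 and must not give parts.
consPart : ℕ → List ℕ → List ℕ
consPart zero    μ = μ
consPart (suc c) μ = suc c ∷ μ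

-- The word is the south-east boundary of the diagram, read from the top right corner:
-- false is a row, true is a column, and the length of a row is the number of columns after it.
toPartition : List Bool → List ℕ
toPartition []          = []
toPartition (true ∷ w)  = toPartition w
toPartition (false ∷ w) = consPart (ones w) (toPartition w)

-- A box is a pair of a false, its row, and a later true, its column. Its hook length is the
-- distance of the two positions, so this is the core condition on the word.
NoZeroOneGap : ℕ → List Bool → Set
NoZeroOneGap t w = ∀ d n → bit w d ≡ false → bit w (d + suc n) ≡ true → ¬ t ∣ suc n

All-consPart : ∀ {P : ℕ → Set} c {μ} → (0 < c → P c) → All P μ → All P (consPart c μ)
All-consPart zero    pc pμ = pμ
All-consPart (suc c) pc pμ = pc z<s ∷ pμ

toPartition≤ones : ∀ w → All (_≤ ones w) (toPartition w)
toPartition≤ones []          = []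
toPartition≤ones (true ∷ w)  = All.map m≤n⇒m≤1+n (toPartition≤ones w)
toPartition≤ones (false ∷ w) = All-consPart (ones w) (λ _ → ≤-refl) (toPartition≤ones w)

Linked-consPart : ∀ c {μ} → All (_≤ c) μ → Linked _≥_ μ → Linked _≥_ (consPart c μ)
Linked-consPart zero    _          l = l
Linked-consPart (suc c) []         l = [-]
Linked-consPart (suc c) (x≤c ∷ _)  l = x≤c ∷ l

toPartition-isPartition : ∀ w → IsPartition (toPartition w)
toPartition-isPartition w = positive w , sorted w
  where
  positive : ∀ w → All (0 <_) (toPartition w)
  positive []          = []
  positive (true ∷ w)  = positive w
  positive (false ∷ w) = All-consPart (ones w) (λ 0<c → 0<c) (positive w)

  sorted : ∀ w → Linked _≥_ (toPartition w)
  sorted []          = []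
  sorted (true ∷ w)  = sorted w
  sorted (false ∷ w) = Linked-consPart (ones w) (toPartition≤ones w) (sorted w)

-- Hook lengths as distances in the word.

legs : ℕ → List ℕ → ℕ
legs j μ = length (filter (j <?_) μ)

legs-consPart : ∀ {c j} μ → j < c → legs j (consPart c μ) ≡ suc (legs j μ)
legs-consPart {suc c} {j} μ j<c = cong length (filter-accept (j <?_) j<c)

legs-top : ∀ w → legs (ones w) (toPartition w) ≡ 0
legs-top w = cong length (filter-none (ones w <?_) (All.map ≤⇒≯ (toPartition≤ones w)))

-- Column `j` is the true with `j` trues after it. Before it stand `ones w ∸ suc j` trues and one
-- false for each row longer than `j`. When a further false is put in front of `w`, these numbers
-- are the arm and the leg of its box in that column.
column-at : ∀ w n → bit w n ≡ true →
  ∃[ j ] (j < ones w × n ≡ ones w ∸ suc j + legs j (toPartition w))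
column-at (true ∷ w) zero _ = ones w , ≤-refl ,
  sym (cong₂ _+_ (n∸n≡0 (ones w)) (legs-top w))
column-at (true ∷ w) (suc n) eq with column-at w n eq
... | j , j<c , n≡ = j , m<n⇒m<1+n j<c , trans (cong suc n≡)
  (cong (_+ legs j (toPartition w)) (sym (+-∸-assoc 1 j<c)))
column-at (false ∷ w) (suc n) eq with column-at w n eq
... | j , j<c , n≡ = j , j<c , trans (cong suc n≡) (trans (sym (+-suc _ _))
  (cong (ones w ∸ suc j +_) (sym (legs-consPart (toPartition w) j<c))))

column-position : ∀ w {j} → j < ones w →
  bit w (ones w ∸ suc j + legs j (toPartition w)) ≡ true
column-position (true ∷ w) {j} j<1+c with m<1+n⇒m<n∨m≡n j<1+c
... | inj₁ j<c  = trans
  (cong (λ n → bit (true ∷ w) (n + legs j (toPartition w))) (+-∸-assoc 1 j<c))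
  (column-position w j<c)
... | inj₂ refl = cong (bit (true ∷ w)) (cong₂ _+_ (n∸n≡0 (ones w)) (legs-top w))
column-position (false ∷ w) {j} j<c = trans
  (cong (bit (false ∷ w)) (trans
    (cong (ones w ∸ suc j +_) (legs-consPart (toPartition w) j<c)) (+-suc _ _)))
  (column-position w j<c)

core⇒noGap : ∀ t w → IsCore t (toPartition w) → NoZeroOneGap t w
core⇒noGap t []          core d n _ ()
core⇒noGap t (true ∷ w)  core (suc d) n z o = core⇒noGap t w core d n z o
core⇒noGap t (false ∷ w) core zero    n _ o with column-at w n o
... | j , j<c , refl with ones w
-- As `j < ones w`, the leading false is a nonempty row, hence the top part, and the gap is the hook
-- length of its box `j`.
... | suc c = core 0 j j<c
core⇒noGap t (false ∷ w) core (suc d) n z o = core⇒noGap t w (tailCore (ones w) core) d n z o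
  where
  tailCore : ∀ c {μ} → IsCore t (consPart c μ) → IsCore t μ
  tailCore zero    core = core
  tailCore (suc c) core i = core (suc i)

noGap⇒core : ∀ t w → NoZeroOneGap t w → IsCore t (toPartition w)
noGap⇒core t []          _   i j ()
noGap⇒core t (true ∷ w)  gap = noGap⇒core t w (λ d → gap (suc d))
noGap⇒core t (false ∷ w) gap
  with ones w | noGap⇒core t w (λ d → gap (suc d)) | (λ j → column-position w {j})
... | zero  | rest | _   = rest
... | suc c | rest | pos = λ where
  zero    j j<c → gap 0 _ refl (pos j j<c)
  (suc i) j     → rest i j

Shifts : ℕ → List Bool → Set
Shifts t w = ∀ d → bit w d ≡ false → bit w (d + t) ≡ false

false≢true : ∀ {b} → b ≡ false → b ≢ true
false≢true refl ()

noGap⇒shifts : ∀ t w → NoZeroOneGap (suc t) w → Shifts (suc t) w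
noGap⇒shifts t w gap d z with bit w (d + suc t) in eq
... | false = refl
... | true  = ⊥-elim (gap d t z eq ∣-refl)

-- Iterated shifts carry a false across every multiple of `t`.
shifts⇒noGap : ∀ t w → Shifts t w → NoZeroOneGap t w
shifts⇒noGap t w shift d n z o (divides q eq) =
  false≢true (subst (λ m → bit w (d + m) ≡ false) (sym eq) (iterate q d z)) o
  where
  iterate : ∀ q d → bit w d ≡ false → bit w (d + q * t) ≡ false
  iterate zero    d z = trans (cong (bit w) (+-identityʳ d)) z
  iterate (suc q) d z = trans (cong (bit w) (sym (+-assoc d t (q * t))))
    (iterate q (d + t) (shift d z))

-- Words up to trailing falses, and injectivity.

ones≡0⇒bit≡false : ∀ w → ones w ≡ 0 → ∀ n → bit w n ≡ false
ones≡0⇒bit≡false []          _  _       = refl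
ones≡0⇒bit≡false (false ∷ w) _  zero    = refl
ones≡0⇒bit≡false (false ∷ w) eq (suc n) = ones≡0⇒bit≡false w eq n

bit≡false⇒ones≡0 : ∀ w → (∀ n → bit w n ≡ false) → ones w ≡ 0
bit≡false⇒ones≡0 []          _ = refl
bit≡false⇒ones≡0 (true ∷ w)  f with f 0
... | ()
bit≡false⇒ones≡0 (false ∷ w) f = bit≡false⇒ones≡0 w (λ n → f (suc n))

ones≡0⇒toPartition≡[] : ∀ w → ones w ≡ 0 → toPartition w ≡ []
ones≡0⇒toPartition≡[] []          _  = refl
ones≡0⇒toPartition≡[] (false ∷ w) eq rewrite eq = ones≡0⇒toPartition≡[] w eq

ones-cong : ∀ w w′ → (∀ n → bit w n ≡ bit w′ n) → ones w ≡ ones w′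
ones-cong []      w′      f = sym (bit≡false⇒ones≡0 w′ (λ n → sym (f n)))
ones-cong (b ∷ w) []      f = bit≡false⇒ones≡0 (b ∷ w) f
ones-cong (b ∷ w) (c ∷ w′) f with f 0 | ones-cong w w′ (λ n → f (suc n))
ones-cong (true  ∷ w) (_ ∷ w′) f | refl | ih = cong suc ih
ones-cong (false ∷ w) (_ ∷ w′) f | refl | ih = ih

-- Words are compared through `bit` because two words of the same diagram may end in different
-- numbers of falses.
toPartition-cong : ∀ w w′ → (∀ n → bit w n ≡ bit w′ n) → toPartition w ≡ toPartition w′
toPartition-cong []      w′       f =
  sym (ones≡0⇒toPartition≡[] w′ (bit≡false⇒ones≡0 w′ (λ n → sym (f n))))
toPartition-cong (b ∷ w) []       f =
  ones≡0⇒toPartition≡[] (b ∷ w) (bit≡false⇒ones≡0 (b ∷ w) f)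
toPartition-cong (b ∷ w) (c ∷ w′) f with f 0 | toPartition-cong w w′ (λ n → f (suc n))
toPartition-cong (true  ∷ w) (_ ∷ w′) f | refl | ih = ih
toPartition-cong (false ∷ w) (_ ∷ w′) f | refl | ih =
  cong₂ consPart (ones-cong w w′ (λ n → f (suc n))) ih

headPart≤ones : ∀ w → part (toPartition w) 0 ≤ ones w
headPart≤ones w with toPartition w | toPartition≤ones w
... | []    | _       = z≤n
... | _ ∷ _ | x≤c ∷ _ = x≤c

headPart-consPart : ∀ w → part (consPart (ones w) (toPartition w)) 0 ≡ ones w
headPart-consPart w with ones w in eq
... | suc c = refl
... | zero  = n≤0⇒n≡0 (subst (part (toPartition w) 0 ≤_) eq (headPart≤ones w))

-- The partition forgets leading trues; equality of `ones` restores them. If the first letters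
-- differ, the word starting with false has a largest part equal to the common number of trues,
-- while the parts of the other word come from one true less and are smaller.
toPartition-injective : ∀ w w′ → ones w ≡ ones w′ → toPartition w ≡ toPartition w′ →
  ∀ n → bit w n ≡ bit w′ n
toPartition-injective []      w′ c≡ _ n = sym (ones≡0⇒bit≡false w′ (sym c≡) n)
toPartition-injective (b ∷ w) [] c≡ _ n = ones≡0⇒bit≡false (b ∷ w) c≡ n
toPartition-injective (true ∷ w) (true ∷ w′) c≡ μ≡ zero    = refl
toPartition-injective (true ∷ w) (true ∷ w′) c≡ μ≡ (suc n) =
  toPartition-injective w w′ (suc-injective c≡) μ≡ n
toPartition-injective (false ∷ w) (false ∷ w′) c≡ μ≡ zero    = refl
toPartition-injective (false ∷ w) (false ∷ w′) c≡ μ≡ (suc n) =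
  toPartition-injective w w′ c≡ (consPart-cancel c≡ μ≡) n
  where
  consPart-cancel : ∀ {c c′ μ μ′} → c ≡ c′ → consPart c μ ≡ consPart c′ μ′ → μ ≡ μ′
  consPart-cancel {zero}  refl eq   = eq
  consPart-cancel {suc c} refl refl = refl
toPartition-injective (true ∷ w) (false ∷ w′) c≡ μ≡ n = ⊥-elim (<-irrefl refl
  (subst (_≤ ones w) (trans (cong (λ μ → part μ 0) μ≡) (trans (headPart-consPart w′) (sym c≡)))
    (headPart≤ones w)))
toPartition-injective (false ∷ w) (true ∷ w′) c≡ μ≡ n = ⊥-elim (<-irrefl refl
  (subst (_≤ ones w′) (trans (cong (λ μ → part μ 0) (sym μ≡)) (trans (headPart-consPart w) c≡))
    (headPart≤ones w′)))

-- The false at position `s` is the top row, followed by as many trues as the largest part. So for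
-- anchored words the partition determines `ones`, as injectivity requires.
ones-anchored : ∀ s w → (∀ n → n < s → bit w n ≡ true) → bit w s ≡ false →
  ones w ≡ s + part (toPartition w) 0
ones-anchored zero    []          _ _ = refl
ones-anchored zero    (false ∷ w) _ _ = sym (headPart-consPart w)
ones-anchored (suc s) []          t _ with t 0 z<s
... | ()
ones-anchored (suc s) (b ∷ w)     t f with t 0 z<s
... | refl = cong suc (ones-anchored s w (λ n n<s → t (suc n) (s<s n<s)) f)

-- The word of a given partition.

toWord : List ℕ → List Bool
toWord []      = []
toWord (x ∷ μ) = false ∷ replicate (x ∸ part μ 0) true ++ toWord μ

toPartition-trues : ∀ c w → toPartition (replicate c true ++ w) ≡ toPartition w
toPartition-trues zero    w = refl
toPartition-trues (suc c) w = toPartition-trues c w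

ones-trues : ∀ c w → ones (replicate c true ++ w) ≡ c + ones w
ones-trues zero    w = refl
ones-trues (suc c) w = cong suc (ones-trues c w)

headPart≤ : ∀ {x μ} → Linked _≥_ (x ∷ μ) → part μ 0 ≤ x
headPart≤ [-]     = z≤n
headPart≤ (r ∷ _) = r

ones-toWord : ∀ μ → Linked _≥_ μ → ones (toWord μ) ≡ part μ 0
ones-toWord []      _ = refl
ones-toWord (x ∷ μ) l = trans (ones-trues (x ∸ part μ 0) (toWord μ))
  (trans (cong (x ∸ part μ 0 +_) (ones-toWord μ (Linked.tail l))) (m∸n+n≡m (headPart≤ l)))

toPartition-toWord : ∀ μ → IsPartition μ → toPartition (toWord μ) ≡ μ
toPartition-toWord []          _              = refl
toPartition-toWord (suc x ∷ μ) (_ ∷ pos , l) = cong₂ consPart (ones-toWord (suc x ∷ μ) l)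
  (trans (toPartition-trues (suc x ∸ part μ 0) (toWord μ))
    (toPartition-toWord μ (pos , Linked.tail l)))

-- Divisibility of the parts as a condition on words.

ones-++ : ∀ u v → ones (u ++ v) ≡ ones u + ones v
ones-++ []          v = refl
ones-++ (true ∷ u)  v = cong suc (ones-++ u v)
ones-++ (false ∷ u) v = ones-++ u v

RowsDivisible : ℕ → List Bool → Set
RowsDivisible p []      = ⊤
RowsDivisible p (b ∷ w) = (b ≡ false → p ∣ ones w) × RowsDivisible p w

parts⇒rows : ∀ p w → All (p ∣_) (toPartition w) → RowsDivisible p w
parts⇒rows p []          _  = tt
parts⇒rows p (true ∷ w)  ps = (λ ()) , parts⇒rows p w ps
parts⇒rows p (false ∷ w) ps = (λ _ → proj₁ (split (ones w) ps)) , parts⇒rows p w (proj₂ (split (ones w) ps))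
  where
  split : ∀ c {μ} → All (p ∣_) (consPart c μ) → p ∣ c × All (p ∣_) μ
  split zero    ps       = p ∣0 , ps
  split (suc c) (d ∷ ps) = d , ps

rows⇒parts : ∀ p w → RowsDivisible p w → All (p ∣_) (toPartition w)
rows⇒parts p []          _        = []
rows⇒parts p (true ∷ w)  (_ , ds) = rows⇒parts p w ds
rows⇒parts p (false ∷ w) (d , ds) = All-consPart (ones w) (λ _ → d refl) (rows⇒parts p w ds)

-- Profiles and their levels.

<ᵇ-true : ∀ {m n} → m < n → (m <ᵇ n) ≡ true
<ᵇ-true {m} {n} m<n with m <ᵇ n | <⇒<ᵇ m<n
... | true | _ = refl

<ᵇ-false : ∀ {m n} → n ≤ m → (m <ᵇ n) ≡ false
<ᵇ-false {m} {n} n≤m with m <ᵇ n in eq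
... | false = refl
... | true  = ⊥-elim (≤⇒≯ n≤m (<ᵇ⇒< m n (subst T (sym eq) tt)))

true⇒< : ∀ {m n} → (m <ᵇ n) ≡ true → m < n
true⇒< {m} {n} eq = <ᵇ⇒< m n (subst T (sym eq) tt)

false⇒≥ : ∀ {m n} → (m <ᵇ n) ≡ false → n ≤ m
false⇒≥ eq = ≮⇒≥ λ m<n → false≢true eq (<ᵇ-true m<n)

-- Line `a` of the word whose column heights are the given list.
level : ℕ → List ℕ → List Bool
level a = map (a <ᵇ_)

above : ℕ → List ℕ → ℕ
above a g = ones (level a g)

-- The upper bound encodes closure under `s`. The last entry being 0 and the others positive says
-- that the word begins with `s` trues followed by a false.
Follows : ℕ → List ℕ → Set
Follows x []      = x ≡ 0
Follows x (y ∷ _) = 0 < x × x ≤ suc y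

Steep : List ℕ → Set
Steep []      = ⊤
Steep (x ∷ g) = Follows x g × Steep g

above-++ : ∀ a g h → above a (g ++ h) ≡ above a g + above a h
above-++ a []      h = refl
above-++ a (x ∷ g) h with a <ᵇ x
... | true  = cong suc (above-++ a g h)
... | false = above-++ a g h

above-replicate< : ∀ {a x} n → a < x → above a (replicate n x) ≡ n
above-replicate< zero    _   = refl
above-replicate< (suc n) a<x rewrite <ᵇ-true a<x = cong suc (above-replicate< n a<x)

above-replicate≥ : ∀ {a x} n → x ≤ a → above a (replicate n x) ≡ 0
above-replicate≥ zero    _   = refl
above-replicate≥ (suc n) x≤a rewrite <ᵇ-false x≤a = above-replicate≥ n x≤a

above-sorted : ∀ {a x g} → Linked _≥_ (x ∷ g) → x ≤ a → above a (x ∷ g) ≡ 0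
above-sorted l       x≤a rewrite <ᵇ-false x≤a = rest l x≤a
  where
  rest : ∀ {a x g} → Linked _≥_ (x ∷ g) → x ≤ a → above a g ≡ 0
  rest [-]       x≤a = refl
  rest (y≤x ∷ l) x≤a = above-sorted l (≤-trans y≤x x≤a)

-- The stack machine and its outputs.

module Parsing (p-1 : ℕ) where

  p : ℕ
  p = suc p-1

  push : ℕ → List ℕ → List ℕ
  push x st = replicate p (suc x) ++ x ∷ st

  -- The outputs of the stack machine started on the given stack and making k pushes.
  parses : ℕ → List ℕ → List (List ℕ)
  parses zero    []       = [] ∷ []
  parses (suc k) []       = []
  parses zero    (x ∷ st) = map (x ∷_) (parses zero st)
  parses (suc k) (x ∷ st) = map (x ∷_) (parses (suc k) st) ++ parses k (push x st)

  raney : ℕ → ℕ → ℕ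
  raney zero    zero    = 1
  raney zero    (suc k) = 0
  raney (suc q) zero    = raney q zero
  raney (suc q) (suc k) = raney q (suc k) + raney (p + suc q) k

  length-push : ∀ x st → length (push x st) ≡ p + suc (length st)
  length-push x st = trans (length-++ (replicate p (suc x)))
    (cong (_+ suc (length st)) (length-replicate p))

  -- The values on the stack do not affect which moves are possible, so the number of runs depends
  -- only on its size.
  length-parses : ∀ k st → length (parses k st) ≡ raney (length st) k
  length-parses zero    []       = refl
  length-parses (suc k) []       = refl
  length-parses zero    (x ∷ st) =
    trans (length-map (List._∷_ x) (parses zero st)) (length-parses zero st)
  length-parses (suc k) (x ∷ st) = trans (length-++ (map (x ∷_) (parses (suc k) st)))
    (cong₂ _+_ (trans (length-map (List._∷_ x) (parses (suc k) st)) (length-parses (suc k) st))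
      (trans (length-parses k (push x st)) (cong (λ n → raney n k) (length-push x st))))

  Fits : List ℕ → List ℕ → Set
  Fits []      []      = ⊤
  Fits (x ∷ _) (y ∷ _) = x ≤ y
  Fits _       _       = ⊥

  data ParseView (g : List ℕ) : ℕ → List ℕ → Set where
    done : g ≡ [] → ParseView g zero []
    pop  : ∀ {k x st} h → g ≡ x ∷ h → h ∈ parses k st → ParseView g k (x ∷ st)
    grow : ∀ {k x st} → g ∈ parses k (push x st) → ParseView g (suc k) (x ∷ st)

  view : ∀ {g} k st → g ∈ parses k st → ParseView g k st
  view zero    []       (here eq) = done eq
  view zero    (x ∷ st) g∈ with ∈-map⁻ (x ∷_) g∈
  ... | h , h∈ , eq = pop h eq h∈
  view (suc k) (x ∷ st) g∈ with ∈-++⁻ (map (x ∷_) (parses (suc k) st)) g∈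
  ... | inj₂ h∈ = grow h∈
  ... | inj₁ h∈ with ∈-map⁻ (x ∷_) h∈
  ...   | h , h∈ , eq = pop h eq h∈

  parses-pop : ∀ {k x st g} → g ∈ parses k st → x ∷ g ∈ parses k (x ∷ st)
  parses-pop {zero}  {x} g∈ = ∈-map⁺ (x ∷_) g∈
  parses-pop {suc k} {x} g∈ = ∈-++⁺ˡ (∈-map⁺ (x ∷_) g∈)

  parses-push : ∀ {k x st g} → g ∈ parses k (push x st) → g ∈ parses (suc k) (x ∷ st)
  parses-push {k} {x} {st} g∈ = ∈-++⁺ʳ (map (x ∷_) (parses (suc k) st)) g∈

  -- Before the first output the top can only be raised.
  fits : ∀ {g} k st → g ∈ parses k st → Fits st g
  fits k st g∈ with view k st g∈
  ... | done refl     = tt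
  ... | pop h refl h∈ = ≤-refl
  ... | grow {k} {x} {st} h∈ with fits k (push x st) h∈
  fits {y ∷ g} _ _ _ | grow h∈ | x<y = <⇒≤ x<y

  -- Every entry is popped once and each push adds `p` of them. Read backwards, the length of an
  -- output determines the number of pushes.
  parses-length : ∀ {g} k st → g ∈ parses k st → length g ≡ k * p + length st
  parses-length k st g∈ with view k st g∈
  ... | done refl     = refl
  ... | pop {st = st} h refl h∈ = trans (cong suc (parses-length k st h∈)) (sym (+-suc _ _))
  ... | grow {k} {x} {st} h∈ = trans (parses-length k (push x st) h∈)
    (trans (cong (k * p +_) (length-push x st)) (arith (k * p) p (suc (length st))))
    where
    arith : ∀ a b c → a + (b + c) ≡ b + a + c
    arith = solve-∀

  -- The first output reveals the first move: it is `x` after a pop and, by `fits`, at least `suc x`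
  -- after a push.
  unique-parses : ∀ k st → Unique (parses k st)
  unique-parses zero    []       = [] ∷ []
  unique-parses (suc k) []       = []
  unique-parses zero    (x ∷ st) = Unique.map⁺ ∷-injectiveʳ (unique-parses zero st)
  unique-parses (suc k) (x ∷ st) = Unique.++⁺
    (Unique.map⁺ ∷-injectiveʳ (unique-parses (suc k) st)) (unique-parses k (push x st))
    λ (u , v) → disjoint u v
    where
    disjoint : ∀ {g} → g ∈ map (x ∷_) (parses (suc k) st) → g ∈ parses k (push x st) → ⊥
    disjoint u v with ∈-map⁻ (x ∷_) u
    ... | _ , _ , refl = <-irrefl refl (fits k (push x st) v)

  infix 4 _≋_
  -- Congruence modulo `p`, written without subtraction.
  _≋_ : ℕ → ℕ → Set
  m ≋ n = ∃₂ λ i j → m + i * p ≡ n + j * p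

  ≋-suc : ∀ {m n} → m ≋ n → suc m ≋ suc n
  ≋-suc (i , j , eq) = i , j , cong suc eq

  ≋-pred : ∀ {m n} → suc m ≋ suc n → m ≋ n
  ≋-pred (i , j , eq) = i , j , suc-injective eq

  ≋-addˡ : ∀ {m n} → m ≋ n → m ≋ p + n
  ≋-addˡ {m} {n} (i , j , eq) = suc i , j , trans (shift m p (i * p)) (trans (cong (p +_) eq) (sym (+-assoc p n _)))
    where
    shift : ∀ a b c → a + (b + c) ≡ b + (a + c)
    shift = solve-∀

  ≋-delˡ : ∀ {m n} → m ≋ p + n → m ≋ n
  ≋-delˡ {m} {n} (i , j , eq) = i , suc j , trans eq (shift p n (j * p))
    where
    shift : ∀ a b c → a + b + c ≡ b + (a + c)
    shift = solve-∀

  ∣-resp-≋ : ∀ {m n} → m ≋ n → p ∣ m → p ∣ n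
  ∣-resp-≋ {m} {n} (i , j , eq) p∣m = ∣m+n∣m⇒∣n
    (subst (p ∣_) (trans eq (+-comm n (j * p))) (∣m∣n⇒∣m+n p∣m (n∣m*n i))) (n∣m*n j)

  ∣-resp-≋ʳ : ∀ {m n} → m ≋ n → p ∣ n → p ∣ m
  ∣-resp-≋ʳ (i , j , eq) = ∣-resp-≋ (j , i , sym eq)

  -- Kept by both moves: a push changes the number of stack entries above `a` by `p` or 0, and a pop
  -- removes the same entry from the stack and from the remaining output.
  SameLevels : List ℕ → List ℕ → Set
  SameLevels g st = ∀ a → above a g ≋ above a st

  above-push< : ∀ {a x} st → a ≤ x → above a (push x st) ≡ p + above a (x ∷ st)
  above-push< {a} {x} st a≤x = trans (above-++ a (replicate p (suc x)) (x ∷ st))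
    (cong (_+ above a (x ∷ st)) (above-replicate< p (s≤s a≤x)))

  above-push≥ : ∀ {a x} st → x < a → above a (push x st) ≡ above a (x ∷ st)
  above-push≥ {a} {x} st x<a = trans (above-++ a (replicate p (suc x)) (x ∷ st))
    (cong (_+ above a (x ∷ st)) (above-replicate≥ p x<a))

  same-cons : ∀ {g st} x → SameLevels g st → SameLevels (x ∷ g) (x ∷ st)
  same-cons x same a with a <ᵇ x
  ... | true  = ≋-suc (same a)
  ... | false = same a

  same-uncons : ∀ {g st} x → SameLevels (x ∷ g) (x ∷ st) → SameLevels g st
  same-uncons x same a with a <ᵇ x | same a
  ... | true  | eq = ≋-pred eq
  ... | false | eq = eq

  same-push : ∀ {g} x st → SameLevels g (x ∷ st) → SameLevels g (push x st)
  same-push {g} x st same a with a ≤? x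
  ... | yes a≤x = subst (above a g ≋_) (sym (above-push< st a≤x)) (≋-addˡ (same a))
  ... | no  a≰x = subst (above a g ≋_) (sym (above-push≥ st (≰⇒> a≰x))) (same a)

  same-unpush : ∀ {g} x st → SameLevels g (push x st) → SameLevels g (x ∷ st)
  same-unpush {g} x st same a with a ≤? x
  ... | yes a≤x = ≋-delˡ (subst (above a g ≋_) (above-push< st a≤x) (same a))
  ... | no  a≰x = subst (above a g ≋_) (above-push≥ st (≰⇒> a≰x)) (same a)

  LevelsDivisible : List ℕ → Set
  LevelsDivisible g = ∀ a → RowsDivisible p (level a g)

  parses-same : ∀ {g} k st → g ∈ parses k st → SameLevels g st
  parses-same {g} k st g∈ with view k st g∈
  ... | done refl               = λ _ → 0 , 0 , refl
  ... | pop {x = x} {st} h refl h∈ = same-cons {h} {st} x (parses-same k st h∈)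
  ... | grow {k} {x} {st} h∈    = same-unpush {g} x st (parses-same k (push x st) h∈)

  steep-push : ∀ x st → Steep (x ∷ st) → Steep (push x st)
  steep-push x st steep = go p-1
    where
    go : ∀ n → Steep (replicate (suc n) (suc x) ++ x ∷ st)
    go zero    = (z<s , ≤-refl) , steep
    go (suc n) = (z<s , n≤1+n _) , go n

  sorted-push : ∀ x st → Linked _≥_ (x ∷ st) → Linked _≥_ (push x st)
  sorted-push x st sorted = go p-1
    where
    go : ∀ n → Linked _≥_ (replicate (suc n) (suc x) ++ x ∷ st)
    go zero    = n≤1+n x ∷ sorted
    go (suc n) = ≤-refl ∷ go n

  follows-fits : ∀ {x} st g → Fits st g → Follows x st → Follows x g
  follows-fits []      []      _   eq        = eq
  follows-fits (y ∷ _) (z ∷ _) y≤z (0<x , x≤y) = 0<x , ≤-trans x≤y (s≤s y≤z)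

  parses-steep : ∀ {g} k st → g ∈ parses k st → Steep st → Steep g
  parses-steep k st g∈ steep with view k st g∈
  ... | done refl = tt
  ... | pop {st = st} h refl h∈ = follows-fits st h (fits k st h∈) (proj₁ steep) ,
    parses-steep k st h∈ (proj₂ steep)
  ... | grow {k} {x} {st} h∈ = parses-steep k (push x st) h∈ (steep-push x st steep)

  -- When an entry `x ≤ a` is popped, the sorted stack holds nothing above `a`, so by `parses-same`
  -- the number of later outputs above `a` is divisible by `p`.
  parses-divisible : ∀ {g} k st → g ∈ parses k st → Linked _≥_ st → LevelsDivisible g
  parses-divisible k st g∈ sorted a with view k st g∈
  ... | done refl = tt
  ... | pop {x = x} {st} h refl h∈ =
    (λ x≤a → ∣-resp-≋ʳ (parses-same k st h∈ a)
      (subst (p ∣_) (sym (trans (sym (cong (λ b → ones (b ∷ level a st)) x≤a))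
        (above-sorted sorted (false⇒≥ x≤a)))) (p ∣0))) ,
    parses-divisible k st h∈ (Linked.tail sorted) a
  ... | grow {k} {x} {st} h∈ =
    parses-divisible k (push x st) h∈ (sorted-push x st sorted) a

  -- Each positive value occurs at most `p` times on the stack.
  ShortGroups : List ℕ → Set
  ShortGroups st = ∀ a → above a st ≤ p + above (suc a) st

  -- The top `x` of a sorted stack is its maximum, so the `p` new entries are the only ones of value
  -- `suc x`.
  groups-push : ∀ x st → Linked _≥_ (x ∷ st) → ShortGroups (x ∷ st) → ShortGroups (push x st)
  groups-push x st sorted short a with <-cmp a x
  ... | tri< a<x _ _ = subst₂ (λ m n → m ≤ p + n) (sym (above-push< st (<⇒≤ a<x)))
          (sym (above-push< st a<x)) (+-monoʳ-≤ p (short a))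
  ... | tri≈ _ refl _ = subst (_≤ p + above (suc x) (push x st)) (sym (above-push< {x} st ≤-refl))
          (+-monoʳ-≤ p (≤-trans (≤-reflexive (above-sorted {x} sorted ≤-refl)) z≤n))
  ... | tri> _ _ x<a = subst (_≤ p + above (suc a) (push x st)) (sym (above-push≥ st x<a))
          (≤-trans (≤-reflexive (above-sorted sorted (<⇒≤ x<a))) z≤n)

  groups-tail : ∀ x st → ShortGroups (x ∷ st) → ShortGroups st
  groups-tail x st short a with short a
  ... | le with a <ᵇ x in eq | suc a <ᵇ x in eq′
  ... | true  | true  = s≤s⁻¹ (subst (suc (above a st) ≤_) (+-suc p (above (suc a) st)) le)
  ... | true  | false = <⇒≤ le
  ... | false | false = le
  ... | false | true  = ⊥-elim (false≢true eq (<ᵇ-true (<⇒≤ (true⇒< {suc a} {x} eq′))))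

  -- Relates the stack to `g`, the part of the profile still to be output. The fields `short`,
  -- `divis` and `same` combine in `no-early-descent`, which keeps the machine from getting stuck.
  record Invariant (st g : List ℕ) : Set where
    field
      sorted : Linked _≥_ st
      steepᵍ : Steep g
      steepˢ : Steep st
      short  : ShortGroups st
      divis  : LevelsDivisible g
      same   : SameLevels g st

  invariant-push : ∀ {x st g} → Invariant (x ∷ st) g → Invariant (push x st) g
  invariant-push {x} {st} {g} inv = record
    { sorted = sorted-push x st sorted
    ; steepᵍ = steepᵍ
    ; steepˢ = steep-push x st steepˢ
    ; short  = groups-push x st sorted short
    ; divis  = divis
    ; same   = same-push {g} x st same
    } where open Invariant inv

  invariant-pop : ∀ {x st g} → Invariant (x ∷ st) (x ∷ g) → Invariant st g
  invariant-pop {x} {st} {g} inv = record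
    { sorted = Linked.tail sorted
    ; steepᵍ = proj₂ steepᵍ
    ; steepˢ = proj₂ steepˢ
    ; short  = groups-tail x st short
    ; divis  = λ a → proj₂ (divis a)
    ; same   = same-uncons {g} {st} x same
    } where open Invariant inv

  -- If the top group, of value y + 1 and size n, still had an entry left when g descends to y,
  -- then n - 1 would be divisible by p although 0 < n - 1 < p.
  no-early-descent : ∀ {y st g} → ¬ Invariant (suc y ∷ suc y ∷ st) (suc y ∷ y ∷ g)
  no-early-descent {y} {st} {g} inv = <⇒≱ size≤p
    (∣⇒≤ (∣-resp-≋ (subst₂ _≋_ gᵃ≡ sᵃ≡ (same-uncons {y ∷ g} {suc y ∷ st} (suc y) same y)) (proj₁ (proj₂ (divis y)) (<ᵇ-false {y} ≤-refl))))
    where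
    open Invariant inv
    gᵃ≡ : above y (y ∷ g) ≡ above y g
    gᵃ≡ rewrite <ᵇ-false (≤-refl {y}) = refl
    sᵃ≡ : above y (suc y ∷ st) ≡ suc (above y st)
    sᵃ≡ rewrite <ᵇ-true (≤-refl {suc y}) = refl
    sᵃ≡′ : above y (suc y ∷ suc y ∷ st) ≡ suc (suc (above y st))
    sᵃ≡′ rewrite <ᵇ-true (≤-refl {suc y}) = refl
    size≤p : suc (suc (above y st)) ≤ p
    size≤p = subst₂ _≤_ sᵃ≡′
      (trans (cong (p +_) (above-sorted {suc y} sorted ≤-refl)) (+-identityʳ p)) (short y)

  -- If the new top `z` exceeded the next output `y`, then `z ≤ x ≤ suc y` would force `z` and `x`
  -- to equal `suc y`, which `no-early-descent` excludes. The stack and the output end together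
  -- because only the last entry of a steep list is 0.
  fits-pop : ∀ {x} st g → Invariant (x ∷ st) (x ∷ g) → Fits st g
  fits-pop []       []      inv = tt
  fits-pop []       (y ∷ g) inv with Invariant.steepᵍ inv | Invariant.steepˢ inv
  ... | (() , _) , _ | refl , _
  fits-pop (z ∷ st) []      inv with Invariant.steepᵍ inv | Invariant.steepˢ inv
  ... | refl , _ | (() , _) , _
  fits-pop {x} (z ∷ st) (y ∷ g) inv with z ≤? y
  ... | yes z≤y = z≤y
  ... | no  z≰y with Invariant.sorted inv | proj₂ (proj₁ (Invariant.steepᵍ inv))
  ...   | z≤x ∷ _ | x≤1+y with ≤-antisym x≤1+y (≤-trans (≰⇒> z≰y) z≤x)
  ...     | refl with ≤-antisym z≤x (≰⇒> z≰y)
  ...       | refl = ⊥-elim (no-early-descent inv)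

  -- The moves are forced: push `d` times until the top equals the next output, then pop. The
  -- recursion is on the output and, for a fixed output, on `d`.
  parse : ∀ g x st d {y} → d + x ≡ y → Invariant (x ∷ st) (y ∷ g) →
    ∃[ k ] y ∷ g ∈ parses k (x ∷ st)
  parse g x st (suc d) eq inv
    with parse g (suc x) (replicate p-1 (suc x) ++ x ∷ st) d (trans (+-suc d x) eq) (invariant-push inv)
  ... | k , g∈ = suc k , parses-push {k} {x} {st} g∈
  parse []      x []       zero refl inv = 0 , parses-pop {0} {x} {[]} (here refl)
  parse (y ∷ g) x []       zero refl inv = ⊥-elim (fits-pop [] (y ∷ g) inv)
  parse []      x (z ∷ st) zero refl inv = ⊥-elim (fits-pop (z ∷ st) [] inv)
  parse (y ∷ g) x (z ∷ st) zero refl inv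
    with parse g z st (y ∸ z) (m∸n+n≡m (fits-pop (z ∷ st) (y ∷ g) inv)) (invariant-pop inv)
  ... | k , g∈ = k , parses-pop {k} {x} g∈

-- The word with given column heights.

rows : ℕ → ℕ → List ℕ → List Bool
rows zero    a g = []
rows (suc M) a g = level a g ++ rows M (suc a) g

bit-++ˡ : ∀ u v {n} → n < length u → bit (u ++ v) n ≡ bit u n
bit-++ˡ (b ∷ u) v {zero}  _         = refl
bit-++ˡ (b ∷ u) v {suc n} (s≤s n<u) = bit-++ˡ u v n<u

bit-++ʳ : ∀ u v n → bit (u ++ v) (length u + n) ≡ bit v n
bit-++ʳ []      v n = refl
bit-++ʳ (b ∷ u) v n = bit-++ʳ u v n

bit-level : ∀ a g b → bit (level a g) b ≡ (a <ᵇ part g b)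
bit-level a []      b       = refl
bit-level a (x ∷ g) zero    = refl
bit-level a (x ∷ g) (suc b) = bit-level a g b

bit-rows : ∀ M a g i {b} → b < length g → part g b ≤ a + M →
  bit (rows M a g) (i * length g + b) ≡ (a + i <ᵇ part g b)
-- No line is left; the bound on `part g b` makes the right-hand side false as well.
bit-rows zero    a g i       b<g g≤ =
  sym (<ᵇ-false (≤-trans g≤ (≤-trans (≤-reflexive (+-identityʳ a)) (m≤m+n a i))))
bit-rows (suc M) a g zero {b} b<g g≤ = trans
  (bit-++ˡ (level a g) _ (subst (b <_) (sym (length-map (a <ᵇ_) g)) b<g))
  (trans (bit-level a g b) (cong (_<ᵇ part g b) (sym (+-identityʳ a))))
bit-rows (suc M) a g (suc i) {b} b<g g≤ = trans
  (cong (bit (rows (suc M) a g)) (trans (+-assoc (length g) (i * length g) b)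
    (cong (_+ (i * length g + b)) (sym (length-map (a <ᵇ_) g)))))
  (trans (bit-++ʳ (level a g) (rows M (suc a) g) (i * length g + b))
    (trans (bit-rows M (suc a) g i b<g (subst (part g b ≤_) (+-suc a M) g≤))
      (cong (_<ᵇ part g b) (sym (+-suc a i)))))

part≤sum : ∀ g b → part g b ≤ sum g
part≤sum []      b       = z≤n
part≤sum (x ∷ g) zero    = m≤m+n x (sum g)
part≤sum (x ∷ g) (suc b) = ≤-trans (part≤sum g b) (m≤n+m (sum g) x)

all≤sum : ∀ g → All (_≤ sum g) g
all≤sum []      = []
all≤sum (x ∷ g) = m≤m+n x (sum g) ∷ All.map (λ y≤ → ≤-trans y≤ (m≤n+m (sum g) x)) (all≤sum g)

-- When w is cut into lines of length S, the trues at residue b fill the first g b lines.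
Columns : ℕ → List Bool → List ℕ → Set
Columns S w g = ∀ i b → b < S → bit w (i * S + b) ≡ (i <ᵇ part g b)

-- The sum serves as a bound on all entries; the surplus lines consist of falses.
skyline : List ℕ → List Bool
skyline g = rows (sum g) 0 g

skyline-columns : ∀ g → Columns (length g) (skyline g) g
skyline-columns g i b b<g = bit-rows (sum g) 0 g i b<g (part≤sum g b)

split-index : ∀ s n → n ≡ (n / suc s) * suc s + n % suc s
split-index s n = trans (m≡m%n+[m/n]*n n (suc s)) (+-comm (n % suc s) _)

columns-bit : ∀ {s w g} → Columns (suc s) w g → ∀ n → bit w n ≡ (n / suc s <ᵇ part g (n % suc s))
columns-bit {s} {w} cols n =
  trans (cong (bit w) (split-index s n)) (cols (n / suc s) (n % suc s) (m%n<n n (suc s)))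

<ᵇ-ext : ∀ m n → (∀ i → (i <ᵇ m) ≡ (i <ᵇ n)) → m ≡ n
<ᵇ-ext m n eq = ≤-antisym (false⇒≥ (trans (eq n) (<ᵇ-false {n} ≤-refl)))
                          (false⇒≥ (trans (sym (eq m)) (<ᵇ-false {m} ≤-refl)))

part-ext : ∀ g h → length g ≡ length h → (∀ b → b < length g → part g b ≡ part h b) → g ≡ h
part-ext []      []      _  _ = refl
part-ext (x ∷ g) (y ∷ h) l≡ f = cong₂ _∷_ (f 0 z<s)
  (part-ext g h (suc-injective l≡) (λ b b<g → f (suc b) (s<s b<g)))

-- Closure under shifts and steepness.

steep-part : ∀ g {b} → Steep g → suc b < length g →
  0 < part g b × part g b ≤ suc (part g (suc b))
steep-part (x ∷ y ∷ g) {zero}  (f , _)  _         = f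
steep-part (x ∷ y ∷ g) {suc b} (_ , st) (s≤s b<g) = steep-part (y ∷ g) st b<g
steep-part (x ∷ [])            _        (s≤s ())

steep-last : ∀ g {s} → Steep g → length g ≡ suc s → part g s ≡ 0
steep-last (x ∷ [])    (x≡0 , _) refl = x≡0
steep-last (x ∷ y ∷ g) (_ , st)  refl = steep-last (y ∷ g) st refl

steep-intro : ∀ g {s} → length g ≡ suc s → part g s ≡ 0 →
  (∀ b → b < s → 0 < part g b × part g b ≤ suc (part g (suc b))) → Steep g
steep-intro (x ∷ [])    refl last _ = last , tt
steep-intro (x ∷ y ∷ g) refl last f = f 0 z<s ,
  steep-intro (y ∷ g) refl last (λ b b<s → f (suc b) (s<s b<s))

module _ {s w g} (len : length g ≡ suc s) (cols : Columns (suc s) w g) where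

  shifts-S : Shifts (suc s) w
  shifts-S d z = trans (cong (bit w) (trans (cong (_+ suc s) (split-index s d))
      (rearrange (d / suc s * suc s) (d % suc s) (suc s))))
    (trans (cols (suc (d / suc s)) (d % suc s) (m%n<n d (suc s)))
      (<ᵇ-false {n = part g (d % suc s)} (m≤n⇒m≤1+n (false⇒≥ {d / suc s} (trans (sym (columns-bit {s} {w} {g} cols d)) z)))))
    where
    rearrange : ∀ a b c → a + b + c ≡ c + a + b
    rearrange = solve-∀

  -- Adding `s` leads to the next line and one residue back, where steepness bounds the height. From
  -- residue 0 it leads to residue `s` of the same line, where the height is 0.
  steep⇒shifts-s : Steep g → Shifts s w
  steep⇒shifts-s steep d z with d / suc s | d % suc s | split-index s d | m%n<n d (suc s)
  ... | i | zero  | refl | _ = trans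
    (cong (bit w) (cong (_+ s) (+-identityʳ (i * suc s))))
    (trans (cols i s ≤-refl) (<ᵇ-false (≤-trans (≤-reflexive (steep-last g steep len)) z≤n)))
  ... | i | suc b | refl | 1+b<S = trans (cong (bit w) (rearrange (i * suc s) b s))
    (trans (cols (suc i) b (<⇒≤ 1+b<S)) (<ᵇ-false (≤-trans
      (proj₂ (steep-part g steep (subst (suc b <_) (sym len) 1+b<S)))
      (s≤s (false⇒≥ {i} (trans (sym (cols i (suc b) 1+b<S)) z))))))
    where
    rearrange : ∀ a b c → a + suc b + c ≡ suc c + a + b
    rearrange = solve-∀

  steep⇒anchored : Steep g → (∀ n → n < s → bit w n ≡ true) × bit w s ≡ false
  steep⇒anchored steep =
    (λ n n<s → trans (cols 0 n (m<n⇒m<1+n n<s))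
      (<ᵇ-true (proj₁ (steep-part g steep (subst (suc n <_) (sym len) (s<s n<s)))))) ,
    trans (cols 0 s ≤-refl) (cong (0 <ᵇ_) (steep-last g steep len))

  shifts⇒steep : (∀ n → n < s → bit w n ≡ true) → bit w s ≡ false → Shifts s w → Steep g
  shifts⇒steep anchor end shift = steep-intro g len
    (n≤0⇒n≡0 (false⇒≥ (trans (sym (cols 0 s ≤-refl)) end)))
    λ b b<s → true⇒< (trans (sym (cols 0 b (m<n⇒m<1+n b<s))) (anchor b b<s)) ,
      -- The first false of residue `suc b` is in line `part g (suc b)`; its shift by `s` is the
      -- letter of residue `b` one line later.
      false⇒≥ (trans (sym (cols (suc (part g (suc b))) b (m<n⇒m<1+n b<s)))
        (trans (cong (bit w) (rearrange (part g (suc b) * suc s) b s))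
          (shift _ (trans (cols (part g (suc b)) (suc b) (s<s b<s)) (<ᵇ-false {part g (suc b)} ≤-refl)))))
    where
    rearrange : ∀ a b c → suc c + a + b ≡ a + suc b + c
    rearrange = solve-∀

-- Column heights of a given word.

height : ℕ → (ℕ → Bool) → ℕ
height zero    c = 0
height (suc N) c with c 0
... | false = 0
... | true  = suc (height N (λ i → c (suc i)))

height-<ᵇ : ∀ N c → (∀ i → c i ≡ false → c (suc i) ≡ false) → (∀ i → N ≤ i → c i ≡ false) →
  ∀ i → c i ≡ (i <ᵇ height N c)
height-<ᵇ zero    c down end i = end i z≤n
height-<ᵇ (suc N) c down end i with c 0 in eq
... | false = constant i
  where
  constant : ∀ i → c i ≡ false
  constant zero    = eq
  constant (suc i) = down i (constant i)
height-<ᵇ (suc N) c down end zero    | true = eq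
height-<ᵇ (suc N) c down end (suc i) | true =
  height-<ᵇ N (λ i → c (suc i)) (λ i → down (suc i)) (λ i N≤i → end (suc i) (s≤s N≤i)) i

part-applyUpTo : ∀ f {n b} → b < n → part (applyUpTo f n) b ≡ f b
part-applyUpTo f {suc n} {zero}  _         = refl
part-applyUpTo f {suc n} {suc b} (s≤s b<n) = part-applyUpTo (λ i → f (suc i)) b<n

bit-beyond : ∀ w n → length w ≤ n → bit w n ≡ false
bit-beyond []      n       _         = refl
bit-beyond (b ∷ w) (suc n) (s≤s w≤n) = bit-beyond w n w≤n

heights : ℕ → List Bool → List ℕ
heights S w = applyUpTo (λ b → height (length w) (λ i → bit w (i * S + b))) S

heights-columns : ∀ s w → Shifts (suc s) w → Columns (suc s) w (heights (suc s) w)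
heights-columns s w shift i b b<S = trans
  (height-<ᵇ (length w) (λ i → bit w (i * suc s + b))
    (λ i z → trans (cong (bit w) (rearrange (i * suc s) b (suc s))) (shift _ z))
    -- Line `i` starts at position `i * suc s`, which is at least `i`, so searching `length w` lines
    -- is enough.
    (λ i w≤i → bit-beyond w _ (≤-trans w≤i (≤-trans (m≤m*n i (suc s)) (m≤m+n _ b)))) i)
  (cong (i <ᵇ_) (sym (part-applyUpTo (λ b → height (length w) (λ i → bit w (i * suc s + b))) b<S)))
  where
  rearrange : ∀ a b c → c + a + b ≡ a + b + c
  rearrange = solve-∀

-- Divisibility line by line.

divisible-++ : ∀ {p} u v → RowsDivisible p u → p ∣ ones v → RowsDivisible p v →
  RowsDivisible p (u ++ v)
divisible-++         []      v _        _ dv = dv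
divisible-++ {p} (b ∷ u) v (d , du) e dv =
  (λ eq → subst (p ∣_) (sym (ones-++ u v)) (∣m∣n⇒∣m+n (d eq) e)) , divisible-++ u v du e dv

divisible-++⁻ʳ : ∀ {p} u v → RowsDivisible p (u ++ v) → RowsDivisible p v
divisible-++⁻ʳ []      v d       = d
divisible-++⁻ʳ (b ∷ u) v (_ , d) = divisible-++⁻ʳ u v d

divisible-++⁻ˡ : ∀ {p} u v → p ∣ ones v → RowsDivisible p (u ++ v) → RowsDivisible p u
divisible-++⁻ˡ         []      v e _       = tt
divisible-++⁻ˡ {p} (b ∷ u) v e (d , ds) =
  (λ eq → ∣m+n∣m⇒∣n (subst (p ∣_) (trans (ones-++ u v) (+-comm (ones u) _)) (d eq)) e) ,
  divisible-++⁻ˡ u v e ds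

-- The last entry of a steep list is 0, so each line ends with a false, whose row has length
-- `ones v`.
divisible-after-level : ∀ {p a v} x g → Steep (x ∷ g) →
  RowsDivisible p (level a (x ∷ g) ++ v) → p ∣ ones v
divisible-after-level x []      (refl , _) (d , _) = d refl
divisible-after-level x (y ∷ g) (_ , st)   (_ , d) = divisible-after-level y g st d

above-bounded : ∀ {a g} → All (_≤ a) g → above a g ≡ 0
above-bounded []         = refl
above-bounded (x≤a ∷ xs) rewrite <ᵇ-false x≤a = above-bounded xs

ones≡0⇒divisible : ∀ {p} w → ones w ≡ 0 → RowsDivisible p w
ones≡0⇒divisible         []          _  = tt
ones≡0⇒divisible {p} (false ∷ w) eq = (λ _ → subst (p ∣_) (sym eq) (p ∣0)) , ones≡0⇒divisible w eq

levels⇒rows : ∀ {p g} → (∀ a → RowsDivisible p (level a g)) → (∀ a → p ∣ above (suc a) g) →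
  ∀ M a → RowsDivisible p (rows M a g)
levels⇒rows             lev tot zero    a = tt
levels⇒rows {p} {g} lev tot (suc M) a =
  divisible-++ (level a g) (rows M (suc a) g) (lev a) (total M a) (levels⇒rows lev tot M (suc a))
  where
  total : ∀ M a → p ∣ ones (rows M (suc a) g)
  total zero    a = p ∣0
  total (suc M) a = subst (p ∣_) (sym (ones-++ (level (suc a) g) _))
    (∣m∣n⇒∣m+n (tot a) (total M (suc a)))

-- The false ending a line shows that the following lines have a total divisible by `p`; subtracting
-- it from a row or from the whole total leaves a single line.
rows⇒levels : ∀ {p} x g → Steep (x ∷ g) → ∀ M a → All (_≤ a + M) (x ∷ g) →
  RowsDivisible p (rows M a (x ∷ g)) → p ∣ ones (rows M a (x ∷ g)) →
  ∀ c → a ≤ c → RowsDivisible p (level c (x ∷ g)) × p ∣ above c (x ∷ g)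
rows⇒levels {p} x g steep zero a g≤ d tot c a≤c =
  ones≡0⇒divisible (level c (x ∷ g)) none , subst (p ∣_) (sym none) (p ∣0)
  where
  none : above c (x ∷ g) ≡ 0
  none = above-bounded (All.map (λ y≤ → ≤-trans y≤ (≤-trans (≤-reflexive (+-identityʳ a)) a≤c)) g≤)
rows⇒levels {p} x g steep (suc M) a g≤ d tot c a≤c with m≤n⇒m<n∨m≡n a≤c
... | inj₁ a<c  = rows⇒levels x g steep M (suc a)
  (All.map (λ {y} y≤ → subst (y ≤_) (+-suc a M) y≤) g≤)
  (divisible-++⁻ʳ (level a (x ∷ g)) _ d) (divisible-after-level {a = a} x g steep d) c a<c
... | inj₂ refl = divisible-++⁻ˡ (level a (x ∷ g)) _ rest d ,
  ∣m+n∣m⇒∣n (subst (p ∣_) (trans (ones-++ (level a (x ∷ g)) _) (+-comm (above a (x ∷ g)) _)) tot) rest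
  where
  rest : p ∣ ones (rows M (suc a) (x ∷ g))
  rest = divisible-after-level {a = a} x g steep d

skyline⇒levels : ∀ {p} g → Steep g → RowsDivisible p (skyline g) →
  (∀ a → RowsDivisible p (level a g)) × (∀ a → p ∣ above (suc a) g)
skyline⇒levels {p} []      _     _ = (λ _ → tt) , (λ _ → p ∣0)
skyline⇒levels {p} (x ∷ g) steep d with sum (x ∷ g) | all≤sum (x ∷ g)
... | zero  | g≤ = (λ a → proj₁ (high a z≤n)) , (λ a → proj₂ (high (suc a) z≤n))
  where
  high : ∀ c → 0 ≤ c → RowsDivisible p (level c (x ∷ g)) × p ∣ above c (x ∷ g)
  high = rows⇒levels x g steep 0 0 g≤ tt (p ∣0)
... | suc M | g≤ = low , (λ a → proj₂ (high (suc a) (s≤s z≤n)))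
  where
  rest : p ∣ ones (rows M 1 (x ∷ g))
  rest = divisible-after-level {a = 0} x g steep d
  high : ∀ c → 1 ≤ c → RowsDivisible p (level c (x ∷ g)) × p ∣ above c (x ∷ g)
  high = rows⇒levels x g steep M 1 g≤ (divisible-++⁻ʳ (level 0 (x ∷ g)) _ d) rest
  low : ∀ a → RowsDivisible p (level a (x ∷ g))
  low zero    = divisible-++⁻ˡ (level 0 (x ∷ g)) _ rest d
  low (suc a) = proj₁ (high (suc a) (s≤s z≤n))

above-zero-steep : ∀ x g → Steep (x ∷ g) → above 0 (x ∷ g) ≡ length g
above-zero-steep x []      (refl , _)          = refl
above-zero-steep x (y ∷ g) ((0<x , _) , steep) rewrite <ᵇ-true 0<x =
  cong suc (above-zero-steep y g steep)

-- Binomial identities and Raney numbers.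

-- The rule (k + 1) C(n, k + 1) = (n - k) C(n, k) without subtraction, by induction through Pascal's
-- rule.
absorption : ∀ n k → suc k * (n C suc k) + k * (n C k) ≡ n * (n C k)
absorption zero    zero    = refl
absorption zero    (suc k) = cong₂ _+_ (*-zeroʳ (suc (suc k))) (*-zeroʳ (suc k))
absorption (suc n) zero    = trans (+-identityʳ _) (trans (+-identityʳ _)
  (trans (sym (nCk+nC[k+1]≡[n+1]C[k+1] n 0))
    (cong suc (trans (sym (trans (+-identityʳ _) (+-identityʳ _))) (absorption n 0)))))
absorption (suc n) (suc k) = begin
  suc (suc k) * (suc n C suc (suc k)) + suc k * (suc n C suc k)
    ≡⟨ cong₂ (λ x y → suc (suc k) * x + suc k * y)
         (sym (nCk+nC[k+1]≡[n+1]C[k+1] n (suc k))) (sym (nCk+nC[k+1]≡[n+1]C[k+1] n k)) ⟩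
  suc (suc k) * (n C suc k + n C suc (suc k)) + suc k * (n C k + n C suc k)
    ≡⟨ rearrange₁ k (n C k) (n C suc k) (n C suc (suc k)) ⟩
  (suc (suc k) * (n C suc (suc k)) + suc k * (n C suc k))
    + (suc k * (n C suc k) + k * (n C k)) + (n C suc k + n C k)
    ≡⟨ cong₂ (λ x y → x + y + (n C suc k + n C k)) (absorption n (suc k)) (absorption n k) ⟩
  n * (n C suc k) + n * (n C k) + (n C suc k + n C k)
    ≡⟨ rearrange₂ n (n C k) (n C suc k) ⟩
  suc n * (n C k + n C suc k)
    ≡⟨ cong (suc n *_) (nCk+nC[k+1]≡[n+1]C[k+1] n k) ⟩
  suc n * (suc n C suc k) ∎
  where
  open ≡-Reasoning
  rearrange₁ : ∀ k x y z → suc (suc k) * (y + z) + suc k * (x + y) ≡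
    (suc (suc k) * z + suc k * y) + (suc k * y + k * x) + (y + x)
  rearrange₁ = solve-∀
  rearrange₂ : ∀ n x y → n * y + n * x + (y + x) ≡ suc n * (x + y)
  rearrange₂ = solve-∀

-- Injectivity is asked for on members only, because distinct lists that are not profiles can have
-- the same partition.
unique-map : ∀ {A B : Set} (f : A → B) {xs} →
  (∀ {x y} → x ∈ xs → y ∈ xs → f x ≡ f y → x ≡ y) → Unique xs → Unique (map f xs)
unique-map f {[]}     inj []       = []
unique-map f {x ∷ xs} inj (x∉ ∷ u) = All.tabulate distinct ∷
  unique-map f (λ y∈ z∈ → inj (there y∈) (there z∈)) u
  where
  distinct : ∀ {y} → y ∈ map f xs → f x ≢ y
  distinct y∈ eq with ∈-map⁻ f y∈
  ... | z , z∈ , refl = All.lookup x∉ z∈ (inj (here refl) (there z∈) eq)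

-- The identity (s + 1) C(s + k + 1, s + 1) = (s + k + 1) C(s + k, s) in terms of the complementary
-- index `k`. It links the two forms of the count.
choose-symmetric-step : ∀ s k → suc s * (suc (s + k) C k) ≡ suc (s + k) * ((s + k) C k)
choose-symmetric-step s zero    = cong (λ n → suc n * 1) (sym (+-identityʳ s))
choose-symmetric-step s (suc k) = begin
  suc s * (suc n C suc k)            ≡⟨ cong (suc s *_) (sym (nCk+nC[k+1]≡[n+1]C[k+1] n k)) ⟩
  suc s * (X + Y)                    ≡⟨ *-distribˡ-+ (suc s) X Y ⟩
  suc s * X + suc s * Y              ≡⟨ cong (_+ suc s * Y) (sym absorbed) ⟩
  suc k * Y + suc s * Y              ≡⟨ collect k s Y ⟩
  suc n * Y                          ∎
  where
  open ≡-Reasoning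
  n = s + suc k
  X = n C k
  Y = n C suc k
  collect : ∀ k s y → suc k * y + suc s * y ≡ suc (s + suc k) * y
  collect = solve-∀
  expand : ∀ k s x → (s + suc k) * x ≡ suc s * x + k * x
  expand = solve-∀
  absorbed : suc k * Y ≡ suc s * X
  absorbed = +-cancelʳ-≡ (k * X) _ _ (trans (absorption n k) (expand k s X))

-- Both sides carry the factor n and the summand P * k * X so that neither division nor
-- subtraction occurs.
raney-step : ∀ P k q A B X Y → let n = suc k * P + q in
  A * n ≡ q * Y → B * n ≡ (P + q) * X → suc k * Y + k * X ≡ n * X →
  (A + B) * suc n * n + P * k * X ≡ suc q * (X + Y) * n + P * k * X
raney-step P k q A B X Y eqA eqB eqXY = begin
  (A + B) * suc n * n + P * k * X
    ≡⟨ distribute A B n (P * k * X) ⟩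
  suc n * (A * n) + suc n * (B * n) + P * k * X
    ≡⟨ cong₂ (λ x y → suc n * x + suc n * y + P * k * X) eqA eqB ⟩
  suc n * (q * Y) + suc n * ((P + q) * X) + P * k * X
    ≡⟨ rearrange₁ P k q X Y ⟩
  P * (n * X) + q * Y + suc q * X * n + q * Y * n
    ≡⟨ cong (λ z → P * z + q * Y + suc q * X * n + q * Y * n) (sym eqXY) ⟩
  P * (suc k * Y + k * X) + q * Y + suc q * X * n + q * Y * n
    ≡⟨ rearrange₂ P k q X Y ⟩
  suc q * (X + Y) * n + P * k * X ∎
  where
  open ≡-Reasoning
  n = suc k * P + q
  distribute : ∀ a b n z → (a + b) * suc n * n + z ≡ suc n * (a * n) + suc n * (b * n) + z
  distribute = solve-∀
  rearrange₁ : ∀ P k q X Y →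
    suc (suc k * P + q) * (q * Y) + suc (suc k * P + q) * ((P + q) * X) + P * k * X ≡
    P * ((suc k * P + q) * X) + q * Y + suc q * X * (suc k * P + q) + q * Y * (suc k * P + q)
  rearrange₁ = solve-∀
  rearrange₂ : ∀ P k q X Y →
    P * (suc k * Y + k * X) + q * Y + suc q * X * (suc k * P + q) + q * Y * (suc k * P + q) ≡
    suc q * (X + Y) * (suc k * P + q) + P * k * X
  rearrange₂ = solve-∀

module Counting (p-1 : ℕ) where
  open Parsing p-1

  -- Induction along the recursion. Both recursive values involve binomials with the same upper
  -- index `n`, namely `n C suc k` and `n C k`, which Pascal's rule joins.
  raney-closed : ∀ q k → raney q k * (k * suc p + q) ≡ q * ((k * suc p + q) C k)
  raney-closed zero    zero    = refl
  raney-closed zero    (suc k) = refl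
  raney-closed (suc q) zero    = trans (cong (_* suc q) (raney-zero q)) (*-comm 1 (suc q))
    where
    raney-zero : ∀ q → raney q zero ≡ 1
    raney-zero zero    = refl
    raney-zero (suc q) = raney-zero q
  raney-closed (suc q) (suc k) = begin
    (A + B) * (suc k * suc p + suc q)          ≡⟨ cong ((A + B) *_) (+-suc (suc k * suc p) q) ⟩
    (A + B) * suc n                            ≡⟨ *-cancelʳ-≡ _ _ n (+-cancelʳ-≡ (suc p * k * X) _ _
      (raney-step (suc p) k q A B X Y (raney-closed q (suc k)) eqB (absorption n k))) ⟩
    suc q * (X + Y)                            ≡⟨ cong (suc q *_) (nCk+nC[k+1]≡[n+1]C[k+1] n k) ⟩
    suc q * (suc n C suc k)                    ≡⟨ cong (λ m → suc q * (m C suc k)) (sym (+-suc (suc k * suc p) q)) ⟩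
    suc q * ((suc k * suc p + suc q) C suc k)  ∎
    where
    open ≡-Reasoning
    n = suc k * suc p + q
    A = raney q (suc k)
    B = raney (p + suc q) k
    X = n C k
    Y = n C suc k
    index : ∀ k p q → k * suc p + (p + suc q) ≡ suc k * suc p + q
    index = solve-∀
    eqB : B * n ≡ (suc p + q) * X
    eqB = trans (cong (B *_) (sym (index k p q))) (trans (raney-closed (p + suc q) k)
      (cong₂ (λ c m → c * (m C k)) (+-suc p q) (index k p q)))

-- Profiles and admissible cores.

module Classification (p-1 k r s-1 : ℕ) (s≡ : suc s-1 ≡ k * suc p-1 + r) (r<p : r < suc p-1) where
  open Parsing p-1

  s : ℕ
  s = suc s-1

  -- Chosen to meet the congruences of a profile: `r` entries above 0, congruent to `s`, and none
  -- above any larger level.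
  start : List ℕ
  start = replicate r 1 ++ 0 ∷ []

  length-start : length start ≡ suc r
  length-start = trans (length-++ (replicate r 1))
    (trans (cong (_+ 1) (length-replicate r)) (+-comm r 1))

  sorted-start : Linked _≥_ start
  sorted-start = go r
    where
    go : ∀ n → Linked _≥_ (replicate n 1 ++ 0 ∷ [])
    go zero          = [-]
    go (suc zero)    = z≤n ∷ [-]
    go (suc (suc n)) = ≤-refl ∷ go (suc n)

  steep-start : Steep start
  steep-start = go r
    where
    go : ∀ n → Steep (replicate n 1 ++ 0 ∷ [])
    go zero          = refl , tt
    go (suc zero)    = (z<s , ≤-refl) , refl , tt
    go (suc (suc n)) = (z<s , s≤s z≤n) , go (suc n)

  above-zero-start : above 0 start ≡ r
  above-zero-start = trans (above-++ 0 (replicate r 1) (0 ∷ []))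
    (trans (+-identityʳ _) (above-replicate< r z<s))

  above-suc-start : ∀ a → above (suc a) start ≡ 0
  above-suc-start a = trans (above-++ (suc a) (replicate r 1) (0 ∷ []))
    (trans (+-identityʳ _) (above-replicate≥ r (s≤s z≤n)))

  short-start : ShortGroups start
  short-start zero    = ≤-trans (≤-reflexive above-zero-start) (≤-trans (<⇒≤ r<p) (m≤m+n p _))
  short-start (suc a) = ≤-trans (≤-reflexive (above-suc-start a)) z≤n

  profiles : List (List ℕ)
  profiles = parses k start

  record Profile (g : List ℕ) : Set where
    field
      size   : length g ≡ suc s
      steep  : Steep g
      levels : LevelsDivisible g
      totals : ∀ a → p ∣ above (suc a) g

  profiles-sound : ∀ {g} → g ∈ profiles → Profile g
  profiles-sound g∈ = record
    { size   = trans (parses-length k start g∈) (trans (cong (k * p +_) length-start)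
        (trans (+-suc (k * p) r) (cong suc (sym s≡))))
    ; steep  = parses-steep k start g∈ steep-start
    ; levels = parses-divisible k start g∈ sorted-start
    ; totals = λ a → ∣-resp-≋ʳ (parses-same k start g∈ (suc a))
        (subst (p ∣_) (sym (above-suc-start a)) (p ∣0))
    }

  start-parses : ∀ g → Invariant start g → Fits start g → ∃[ j ] g ∈ parses j start
  start-parses g inv fit with start
  start-parses (y ∷ g) inv x≤y | x ∷ st = parse g x st (y ∸ x) (m∸n+n≡m x≤y) inv
  start-parses []      inv fit | []     = 0 , here refl

  -- The parser finds `g` with some number `j` of pushes, and the length of `g` forces `j` to be
  -- `k`.
  profiles-complete : ∀ {g} → Profile g → g ∈ profiles
  profiles-complete {g} profile with start-parses g inv fit
    where
    open Profile profile

    same₀ : ∀ g → length g ≡ suc s → Steep g → above 0 g ≡ s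
    same₀ (x ∷ g) size steep = trans (above-zero-steep x g steep) (suc-injective size)

    same : SameLevels g start
    -- By steepness `g` has `s` entries above 0, and `s` exceeds `r` by `k * p`.
    same zero    = 0 , k , (begin
      above 0 g + 0 * p      ≡⟨ +-identityʳ _ ⟩
      above 0 g              ≡⟨ same₀ g size steep ⟩
      s                      ≡⟨ trans s≡ (+-comm (k * p) r) ⟩
      r + k * p              ≡⟨ cong (_+ k * p) (sym above-zero-start) ⟩
      above 0 start + k * p  ∎)
      where open ≡-Reasoning
    same (suc a) with totals a
    ... | divides q eq = 0 , q , trans (+-identityʳ _)
      (trans eq (cong (_+ q * p) (sym (above-suc-start a))))

    inv : Invariant start g
    inv = record
      { sorted = sorted-start
      ; steepᵍ = steep
      ; steepˢ = steep-start
      ; short  = short-start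
      ; divis  = levels
      ; same   = same
      }

    fit : Fits start g
    fit = go r g size steep
      where
      go : ∀ n g → length g ≡ suc s → Steep g → Fits (replicate n 1 ++ 0 ∷ []) g
      go zero    (x ∷ g)     _ _               = z≤n
      go (suc n) (x ∷ y ∷ g) _ ((0<x , _) , _) = 0<x
  ... | j , g∈ = subst (λ i → g ∈ parses i start) (*-cancelʳ-≡ j k p (+-cancelʳ-≡ (suc r) _ _ eq)) g∈
    where
    eq : j * p + suc r ≡ k * p + suc r
    eq = trans (cong (j * p +_) (sym length-start)) (trans (sym (parses-length j start g∈))
      (trans (Profile.size profile) (trans (cong suc s≡) (sym (+-suc (k * p) r)))))

  Admissible : List ℕ → Set
  Admissible μ = IsPartition μ × IsCore s μ × IsCore (suc s) μ × All (p ∣_) μ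

  columns : ∀ {g} → Profile g → Columns (suc s) (skyline g) g
  columns {g} profile = subst (λ S → Columns S (skyline g) g) (Profile.size profile) (skyline-columns g)

  profile⇒admissible : ∀ {g} → Profile g → Admissible (toPartition (skyline g))
  profile⇒admissible {g} profile =
    toPartition-isPartition w ,
    noGap⇒core s w (shifts⇒noGap s w (steep⇒shifts-s {s} {w} {g} size (columns profile) steep)) ,
    noGap⇒core (suc s) w (shifts⇒noGap (suc s) w (shifts-S {s} {w} {g} size (columns profile))) ,
    rows⇒parts p w (levels⇒rows levels totals (sum g) 0)
    where
    open Profile profile
    w = skyline g

  admissible⇒profile : ∀ {μ} → Admissible μ → ∃[ g ] (Profile g × μ ≡ toPartition (skyline g))
  admissible⇒profile {μ} (isPartition , core-s , core-S , p∣μ) =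
    g , profile , sym (trans (sym w≗skyline) w-μ)
    where
    -- The leading trues leave the partition unchanged and put the first false at position `s`, so
    -- that residue `s` has height 0 and all others have positive height.
    w = replicate s true ++ toWord μ
    g = heights (suc s) w

    w-μ : toPartition w ≡ μ
    w-μ = trans (toPartition-trues s (toWord μ)) (toPartition-toWord μ isPartition)

    shift-s : Shifts s w
    shift-s = noGap⇒shifts s-1 w (core⇒noGap s w (subst (IsCore s) (sym w-μ) core-s))

    shift-S : Shifts (suc s) w
    shift-S = noGap⇒shifts s w (core⇒noGap (suc s) w (subst (IsCore (suc s)) (sym w-μ) core-S))

    cols : Columns (suc s) w g
    cols = heights-columns s w shift-S

    size : length g ≡ suc s
    size = length-applyUpTo (λ b → height (length w) (λ i → bit w (i * suc s + b))) (suc s)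

    anchored : ∀ n m v → n < m → bit (replicate m true ++ v) n ≡ true
    anchored zero    (suc m) v _         = refl
    anchored (suc n) (suc m) v (s≤s n<m) = anchored n m v n<m

    end : ∀ m μ → bit (replicate m true ++ toWord μ) m ≡ false
    end zero    []      = refl
    end zero    (x ∷ μ) = refl
    end (suc m) μ       = end m μ

    steep : Steep g
    steep = shifts⇒steep {s} {w} {g} size cols (λ n → anchored n s (toWord μ)) (end s μ) shift-s

    w≗skyline : toPartition w ≡ toPartition (skyline g)
    w≗skyline = toPartition-cong w (skyline g) λ n → trans (columns-bit {s} {w} {g} cols n)
      (sym (columns-bit {s} {skyline g} {g}
        (subst (λ S → Columns S (skyline g) g) size (skyline-columns g)) n))

    divisible : (∀ a → RowsDivisible p (level a g)) × (∀ a → p ∣ above (suc a) g)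
    divisible = skyline⇒levels g steep
      (parts⇒rows p (skyline g) (subst (All (p ∣_)) (trans (sym w-μ) w≗skyline) p∣μ))

    profile : Profile g
    profile = record
      { size = size ; steep = steep ; levels = proj₁ divisible ; totals = proj₂ divisible }

  -- The heights can be read off the word, and the partition determines the word because anchoring
  -- fixes its number of trues.
  skyline-injective : ∀ {g h} → Profile g → Profile h →
    toPartition (skyline g) ≡ toPartition (skyline h) → g ≡ h
  skyline-injective {g} {h} pg ph eq = part-ext g h
    (trans (Profile.size pg) (sym (Profile.size ph)))
    λ b b<g → let b<S = subst (b <_) (Profile.size pg) b<g in
      <ᵇ-ext (part g b) (part h b) λ i → trans (sym (columns pg i b b<S))
        (trans (toPartition-injective (skyline g) (skyline h) ones≡ eq (i * suc s + b))
          (columns ph i b b<S))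
    where
    ones-skyline : ∀ {g} → Profile g → ones (skyline g) ≡ s + part (toPartition (skyline g)) 0
    ones-skyline {g} pg with steep⇒anchored {s} {skyline g} {g}
      (Profile.size pg) (columns pg) (Profile.steep pg)
    ... | anchor , end = ones-anchored s (skyline g) anchor end

    ones≡ : ones (skyline g) ≡ ones (skyline h)
    ones≡ = trans (ones-skyline pg) (trans (cong (λ μ → s + part μ 0) eq) (sym (ones-skyline ph)))

  cores : List (List ℕ)
  cores = map (λ g → toPartition (skyline g)) profiles

  cores-unique : Unique cores
  cores-unique = unique-map _
    (λ g∈ h∈ → skyline-injective (profiles-sound g∈) (profiles-sound h∈)) (unique-parses k start)

  cores-admissible : ∀ μ → (μ ∈ cores) ⇔ Admissible μ
  cores-admissible μ = mk⇔ sound complete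
    where
    sound : μ ∈ cores → Admissible μ
    sound μ∈ with ∈-map⁻ _ μ∈
    ... | g , g∈ , refl = profile⇒admissible (profiles-sound g∈)

    complete : Admissible μ → μ ∈ cores
    complete adm with admissible⇒profile adm
    ... | g , profile , refl = ∈-map⁺ _ (profiles-complete profile)

  length-cores : length cores ≡ raney (suc r) k
  length-cores = trans (length-map _ profiles)
    (trans (length-parses k start) (cong (λ q → raney q k) length-start))

-- The two formulas for the number of cores.

theorem3p1 : (s p k r : ℕ) → (hs : 0 < s) → (hp : 0 < p) → s ≡ k * p + r → r < p →
    ∃[ L ] (Unique L
    × (∀ (μ : List ℕ) → (μ ∈ L) ⇔ (IsPartition μ × IsCore s μ × IsCore (suc s) μ × All (p ∣_) μ))
    × length L * (k * suc p + suc r) ≡ suc r * ((k * suc p + suc r) C k)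
    × length L * suc s ≡ (suc s ∸ p * divFloor s p hp) * ((s + divFloor s p hp) C s))
theorem3p1 (suc s-1) (suc p-1) k r hs hp s≡ r<p = cores , cores-unique , cores-admissible ,
  subst (λ N → N * (k * suc p + suc r) ≡ suc r * ((k * suc p + suc r) C k)) (sym length-cores)
    (raney-closed (suc r) k) ,
  subst₂ (λ N m → N * suc s ≡ (suc s ∸ p * m) * ((s + m) C s)) (sym length-cores) (sym floor≡k) count
  where
  open Classification p-1 k r s-1 s≡ r<p
  open Parsing p-1
  open Counting p-1

  floor≡k : divFloor s p hp ≡ k
  floor≡k = begin
    s / p              ≡⟨ cong (_/ p) s≡ ⟩
    (k * p + r) / p    ≡⟨ +-distrib-/-∣ˡ r (n∣m*n k) ⟩
    k * p / p + r / p  ≡⟨ cong₂ _+_ (m*n/n≡m k p) (m<n⇒m/n≡0 r<p) ⟩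
    k + 0              ≡⟨ +-identityʳ k ⟩
    k                  ∎
    where open ≡-Reasoning

  remainder : suc s ∸ p * k ≡ suc r
  remainder = trans (cong₂ (λ x y → suc x ∸ y) s≡ (*-comm p k))
    (trans (cong (_∸ k * p) (sym (+-suc (k * p) r))) (m+n∸m≡n (k * p) (suc r)))

  total : k * suc p + suc r ≡ suc (s + k)
  total = trans (arith k p r) (cong (λ x → suc (x + k)) (sym s≡))
    where
    arith : ∀ k p r → k * suc p + suc r ≡ suc (k * p + r + k)
    arith = solve-∀

  N = raney (suc r) k

  -- The factor `suc (s + k)` is the denominator of the Raney form; it is multiplied in to apply
  -- `closed` and cancelled at the end.
  count : N * suc s ≡ (suc s ∸ p * k) * ((s + k) C s)
  count = *-cancelʳ-≡ _ _ (suc (s + k)) (begin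
    N * suc s * suc (s + k)                          ≡⟨ swap N (suc s) (suc (s + k)) ⟩
    N * suc (s + k) * suc s                          ≡⟨ cong (_* suc s) closed ⟩
    suc r * (suc (s + k) C k) * suc s                ≡⟨ swap′ (suc r) (suc (s + k) C k) (suc s) ⟩
    suc r * (suc s * (suc (s + k) C k))              ≡⟨ cong (suc r *_) (choose-symmetric-step s k) ⟩
    suc r * (suc (s + k) * ((s + k) C k))            ≡⟨ sym (swap′ (suc r) ((s + k) C k) (suc (s + k))) ⟩
    suc r * ((s + k) C k) * suc (s + k)              ≡⟨ cong₂ (λ x y → x * y * suc (s + k)) (sym remainder) choose-sym ⟩
    (suc s ∸ p * k) * ((s + k) C s) * suc (s + k)    ∎)
    where
    open ≡-Reasoning
    swap : ∀ a b c → a * b * c ≡ a * c * b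
    swap = solve-∀
    swap′ : ∀ a b c → a * b * c ≡ a * (c * b)
    swap′ = solve-∀
    closed : N * suc (s + k) ≡ suc r * (suc (s + k) C k)
    closed = subst (λ n → N * n ≡ suc r * (n C k)) total (raney-closed (suc r) k)
    choose-sym : (s + k) C k ≡ (s + k) C s
    choose-sym = trans (nCk≡nC[n∸k] (m≤n+m k s)) (cong ((s + k) C_) (m+n∸n≡m s k))
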